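{- For all positive integers $n$ and $m$, $$\Phi(n\times m,3,2,1)\le\begin{cases} \lfloor n(nm+2\Psi^e(m,3,2,1))/6\rfloor, & \text{if } m\equiv 0\pmod 2,\\ \lfloor n(nm+2\Psi^e(m,3,2,1)-1)/6\rfloor, & \text{if } m\equiv 1\pmod 2. \end{cases}$$
   Context: Let $I_n=\{0,1,\ldots,n-1\}$ and let $Z_m$ be the additive group of integers modulo $m$. For $B\subseteq I_n\times Z_m$ and an integer $s$, put $B+s=\{(i,x+s \bmod m):(i,x)\in B\}$. A $2$-D $(n\times m,3,2,1)$-OOC is a (possibly empty) set $\mathcal{B}$ of $3$-subsets of $I_n\times Z_m$ (codewords) such that: (1) $|B\cap(B+s)|\le 2$ for every $B\in\mathcal{B}$ and every integer $s\not\equiv 0\pmod m$; (2) $|A\cap(B+s)|\le 1$ for all $A,B\in\mathcal{B}$ with $A\ne B$ and every integer $s$. $\Phi(n\times m,3,2,1)$ denotes the largest number of codewords among all such codes. When $n=1$ such a code is called a $1$-D $(m,3,2,1)$-OOC and its codewords are regarded as $3$-subsets of $Z_m$. A $1$-D $(m,3,2,1)$-OOC is equi-difference if each of its codewords is of the form $\{0,a,2a\}$ with $a\in Z_m$; $\Psi^e(m,3,2,1)$ denotes the largest number of codewords among all equi-difference $1$-D $(m,3,2,1)$-OOCs. -}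

module Defs where

open import Data.Bool.Base using (true; false; _∨_)
open import Data.Fin.Base using (Fin; zero; suc; toℕ; fromℕ<; combine; remQuot)
open import Data.Fin.Properties using (any?; all?; combine-injective; injective⇒≤; toℕ-fromℕ<)
  renaming (_≟_ to _≟ᶠ_)
open import Data.Fin.Subset using (Subset; ∣_∣; _∩_; _∪_; ⁅_⁆)
open import Data.Fin.Subset.Properties using (_∈?_; anySubset?)
open import Data.Integer.Base as ℤ using (ℤ; +_; 0ℤ; _%ℕ_; _/ℕ_)
open import Data.Integer.Divisibility as ℤ∣ using ()
open import Data.Integer.DivMod using (n%ℕd<d; a≡a%ℕn+[a/ℕn]*n)
import Data.Integer.Properties as ℤₚ
open import Data.Integer.Tactic.RingSolver using (solve-∀)
open import Data.List.Base using (List; []; _∷_; length; lookup)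
open import Data.List.Relation.Unary.All as All using (All; []; _∷_)
open import Data.List.Relation.Unary.AllPairs using ([]; _∷_)
open import Data.List.Relation.Unary.Unique.Propositional using (Unique)
import Data.List.Relation.Unary.Unique.DecPropositional as DecUnique
open import Data.List.Membership.Propositional.Properties using (∈-lookup)
open import Data.Nat.Base using (ℕ; zero; suc; _*_; _^_; _≤_; _<_; _⊔_; NonZero; s≤s⁻¹)
open import Data.Nat.Divisibility as ℕ∣ using (divides)
import Data.Nat.Properties as ℕₚ
open import Data.Product.Base using (∃; _×_; _,_; proj₁; proj₂)
open import Data.Vec.Base using (tabulate; []; _∷_)
open import Data.Vec.Properties using (≡-dec; tabulate-cong)
import Data.Bool.Properties as Bool
open import Function.Base using (_∘_)
open import Relation.Binary.Definitions using (DecidableEquality)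
open import Relation.Binary.PropositionalEquality
open import Relation.Nullary.Decidable using (Dec; yes; no; does; ¬?; map′; _×-dec_; _→-dec_)
open import Relation.Nullary.Negation using (¬_; contradiction)
open import Relation.Unary using (Decidable)

-- I_n × Z_m is encoded as Fin (n * m): `combine i x` stands for the pair (i , x).
Point : ℕ → ℕ → Set
Point n m = Fin (n * m)

PointSet : ℕ → ℕ → Set
PointSet n m = Subset (n * m)

residue : (m : ℕ) .{{_ : NonZero m}} → ℤ → Fin m
residue m z = fromℕ< (n%ℕd<d z m)

module _ {n m : ℕ} .{{_ : NonZero m}} where

  translate : ℤ → Point n m → Point n m
  translate s p = let (i , x) = remQuot {n} m p in
    combine i (residue m (+ toℕ x ℤ.+ s))

  infixl 6 _⊕_
  _⊕_ : PointSet n m → ℤ → PointSet n m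
  B ⊕ s = tabulate λ q → does (any? λ p → (p ∈? B) ×-dec (translate s p ≟ᶠ q))

AutoCorrelation : (n m : ℕ) .{{_ : NonZero m}} → PointSet n m → Set
AutoCorrelation n m B = ∀ s → ¬ (+ m ℤ∣.∣ s) → ∣ B ∩ (_⊕_ {n} B s) ∣ ≤ 2

CrossCorrelation : (n m : ℕ) .{{_ : NonZero m}} → PointSet n m → PointSet n m → Set
CrossCorrelation n m A B = ∀ s → ∣ A ∩ (_⊕_ {n} B s) ∣ ≤ 1

-- A set of codewords is a duplicate-free list; equality of `Subset`s is
-- extensional, so its number of codewords is its length.
record IsOOC (n m : ℕ) .{{_ : NonZero m}} (C : List (PointSet n m)) : Set where
  constructor mkOOC
  field
    distinct : Unique C
    weight   : All (λ B → ∣ B ∣ ≡ 3) C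
    auto     : All (AutoCorrelation n m) C
    cross    : All (λ A → All (λ B → A ≢ B → CrossCorrelation n m A B) C) C

-- {0 , a , 2a} ⊆ Z_m, with x ∈ Z_m identified with (0 , x) ∈ I_1 × Z_m.
progression : (m : ℕ) .{{_ : NonZero m}} → Fin m → PointSet 1 m
progression m a = ⁅ elt 0ℤ ⁆ ∪ ⁅ elt (+ toℕ a) ⁆ ∪ ⁅ elt (+ 2 ℤ.* + toℕ a) ⁆
  where
  elt : ℤ → Point 1 m
  elt z = combine {1} zero (residue m z)

record IsEquiDifferenceOOC (m : ℕ) .{{_ : NonZero m}} (C : List (PointSet 1 m)) : Set where
  constructor mkEquiDifference
  field
    isOOC          : IsOOC 1 m C
    equiDifference : All (λ B → ∃ λ a → B ≡ progression m a) C

IsLargestSize : {A : Set} → (List A → Set) → ℕ → Set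
IsLargestSize P k = (∃ λ C → P C × length C ≡ k) × (∀ C → P C → length C ≤ k)

------------------------------------------------------------------------
-- A decidable property of duplicate-free lists of subsets of a finite set
-- has a largest size as soon as it holds of the empty list.

private
  encode : ∀ {N} → Subset N → Fin (2 ^ N)
  encode []                    = zero
  encode {suc N} (false ∷ v) = combine {2} {2 ^ N} zero (encode v)
  encode {suc N} (true  ∷ v) = combine {2} {2 ^ N} (suc zero) (encode v)

  encode-injective : ∀ {N} (u v : Subset N) → encode u ≡ encode v → u ≡ v
  encode-injective [] [] _ = refl
  encode-injective {suc N} (false ∷ u) (false ∷ v) e =
    cong (false ∷_) (encode-injective u v (proj₂ (combine-injective {2} {2 ^ N} zero _ zero _ e)))
  encode-injective {suc N} (false ∷ u) (true ∷ v) e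
    with () ← proj₁ (combine-injective {2} {2 ^ N} zero (encode u) (suc zero) (encode v) e)
  encode-injective {suc N} (true ∷ u) (false ∷ v) e
    with () ← proj₁ (combine-injective {2} {2 ^ N} (suc zero) (encode u) zero (encode v) e)
  encode-injective {suc N} (true ∷ u) (true ∷ v) e =
    cong (true ∷_) (encode-injective u v (proj₂ (combine-injective {2} {2 ^ N} (suc zero) _ (suc zero) _ e)))

  lookup-injective : ∀ {A : Set} {xs : List A} → Unique xs →
                     ∀ i j → lookup xs i ≡ lookup xs j → i ≡ j
  lookup-injective (_ ∷ _)  zero    zero    _ = refl
  lookup-injective (x∉ ∷ _) zero    (suc j) e = contradiction e (All.lookup x∉ (∈-lookup j))
  lookup-injective (x∉ ∷ _) (suc i) zero    e = contradiction (sym e) (All.lookup x∉ (∈-lookup i))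
  lookup-injective (_ ∷ u)  (suc i) (suc j) e = cong suc (lookup-injective u i j e)

  unique⇒length≤ : ∀ {N} {C : List (Subset N)} → Unique C → length C ≤ 2 ^ N
  unique⇒length≤ {C = C} u = injective⇒≤ {f = encode ∘ lookup C}
    λ {i} {j} e → lookup-injective u i j (encode-injective _ _ e)

  ofLength? : ∀ {N} {P : List (Subset N) → Set} → Decidable P →
              ∀ k → Dec (∃ λ C → P C × length C ≡ k)
  ofLength? P? zero = map′ (λ p → [] , p , refl) (λ { ([] , p , _) → p }) (P? [])
  ofLength? P? (suc k) = map′
    (λ { (x , C , p , e) → x ∷ C , p , cong suc e })
    (λ { (x ∷ C , p , e) → x , C , p , ℕₚ.suc-injective e })
    (anySubset? λ x → ofLength? (P? ∘ (x ∷_)) k)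

abstract
  largestSize : ∀ {N} {P : List (Subset N) → Set} → Decidable P → P [] →
                (∀ {C} → P C → Unique C) → ∃ (IsLargestSize P)
  largestSize {N} {P} P? p[] unique = search (2 ^ N) λ _ → unique⇒length≤ ∘ unique
    where
    search : ∀ b → (∀ C → P C → length C ≤ b) → ∃ (IsLargestSize P)
    search zero    bound = 0 , ([] , p[] , refl) , bound
    search (suc b) bound with ofLength? P? (suc b)
    ... | yes w = suc b , w , bound
    ... | no ¬w = search b λ C p →
      s≤s⁻¹ (ℕₚ.≤∧≢⇒< (bound C p) λ e → ¬w (C , p , e))

------------------------------------------------------------------------
-- Decidability of the code axioms: a shift matters only modulo m.

private
  _≟ˢ_ : ∀ {N} → DecidableEquality (Subset N)
  _≟ˢ_ = ≡-dec Bool._≟_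

  %ℕ-unique : ∀ m r r′ q q′ → r < m → r′ < m →
              + r ℤ.+ q ℤ.* + m ≡ + r′ ℤ.+ q′ ℤ.* + m → r ≡ r′
  %ℕ-unique m r r′ q q′ r<m r′<m e = ℤₚ.+-injective (ℤₚ.i-j≡0⇒i≡j (+ r) (+ r′) (ℤₚ.∣i∣≡0⇒i≡0 (small ∣d∣<m m∣d)))
    where
    rearrange : ∀ a b c d k → a ℤ.- b ≡ (a ℤ.+ c ℤ.* k) ℤ.- (b ℤ.+ d ℤ.* k) ℤ.+ (d ℤ.- c) ℤ.* k
    rearrange = solve-∀
    d≡ : + r ℤ.- + r′ ≡ (q′ ℤ.- q) ℤ.* + m
    d≡ = trans (rearrange (+ r) (+ r′) q q′ (+ m))
      (trans (cong (ℤ._+ (q′ ℤ.- q) ℤ.* + m) (ℤₚ.i≡j⇒i-j≡0 e)) (ℤₚ.+-identityˡ _))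
    m∣d : m ℕ∣.∣ ℤ.∣ + r ℤ.- + r′ ∣
    m∣d = divides ℤ.∣ q′ ℤ.- q ∣ (trans (cong ℤ.∣_∣ d≡) (ℤₚ.abs-* (q′ ℤ.- q) (+ m)))
    ∣d∣<m : ℤ.∣ + r ℤ.- + r′ ∣ < m
    ∣d∣<m = ℕₚ.≤-<-trans
      (subst (λ z → ℤ.∣ z ∣ ≤ r ⊔ r′) (sym (ℤₚ.m-n≡m⊖n r r′)) (ℤₚ.∣m⊝n∣≤m⊔n r r′))
      (ℕₚ.⊔-lub r<m r′<m)
    small : ∀ {k} → k < m → m ℕ∣.∣ k → k ≡ 0
    small {zero}  _   _   = refl
    small {suc k} k<m m∣k = contradiction m∣k (ℕ∣.>⇒∤ k<m)

  module _ (m : ℕ) .{{_ : NonZero m}} where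

    residue-cong : ∀ x s → residue m (x ℤ.+ + (s %ℕ m)) ≡ residue m (x ℤ.+ s)
    residue-cong x s = fromℕ<-cong′ (n%ℕd<d y m) (n%ℕd<d z m)
      (%ℕ-unique m (y %ℕ m) (z %ℕ m) (y /ℕ m ℤ.+ s /ℕ m) (z /ℕ m) (n%ℕd<d y m) (n%ℕd<d z m) eq)
      where
      y = x ℤ.+ + (s %ℕ m)
      z = x ℤ.+ s
      fromℕ<-cong′ : ∀ {a b} (p : a < m) (q : b < m) → a ≡ b → fromℕ< p ≡ fromℕ< q
      fromℕ<-cong′ p q refl = refl
      split : ∀ a b c k → a ℤ.+ (b ℤ.+ c) ℤ.* k ≡ (a ℤ.+ b ℤ.* k) ℤ.+ c ℤ.* k
      split = solve-∀
      eq : + (y %ℕ m) ℤ.+ (y /ℕ m ℤ.+ s /ℕ m) ℤ.* + m ≡ + (z %ℕ m) ℤ.+ (z /ℕ m) ℤ.* + m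
      eq = begin
        + (y %ℕ m) ℤ.+ (y /ℕ m ℤ.+ s /ℕ m) ℤ.* + m
          ≡⟨ split (+ (y %ℕ m)) (y /ℕ m) (s /ℕ m) (+ m) ⟩
        (+ (y %ℕ m) ℤ.+ y /ℕ m ℤ.* + m) ℤ.+ s /ℕ m ℤ.* + m
          ≡⟨ cong (ℤ._+ s /ℕ m ℤ.* + m) (a≡a%ℕn+[a/ℕn]*n y m) ⟨
        (x ℤ.+ + (s %ℕ m)) ℤ.+ s /ℕ m ℤ.* + m
          ≡⟨ ℤₚ.+-assoc x (+ (s %ℕ m)) _ ⟩
        x ℤ.+ (+ (s %ℕ m) ℤ.+ s /ℕ m ℤ.* + m)
          ≡⟨ cong (λ w → x ℤ.+ w) (a≡a%ℕn+[a/ℕn]*n s m) ⟨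
        x ℤ.+ s
          ≡⟨ a≡a%ℕn+[a/ℕn]*n z m ⟩
        + (z %ℕ m) ℤ.+ z /ℕ m ℤ.* + m ∎
        where open ≡-Reasoning

    ∣%ℕ⇒∣ : ∀ s → + m ℤ∣.∣ + (s %ℕ m) → + m ℤ∣.∣ s
    ∣%ℕ⇒∣ s m∣r with s %ℕ m | n%ℕd<d s m | a≡a%ℕn+[a/ℕn]*n s m
    ... | zero  | _   | e = divides ℤ.∣ s /ℕ m ∣
      (trans (cong ℤ.∣_∣ (trans e (ℤₚ.+-identityˡ (s /ℕ m ℤ.* + m)))) (ℤₚ.abs-* (s /ℕ m) (+ m)))
    ... | suc r | r<m | _ = contradiction m∣r (ℕ∣.>⇒∤ r<m)

    allShifts? : {Q : ℤ → Set} → Decidable Q → (∀ s → Q (+ (s %ℕ m)) → Q s) → Dec (∀ s → Q s)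
    allShifts? {Q} Q? reduce = map′
      (λ h s → reduce s (subst (Q ∘ +_) (toℕ-fromℕ< (n%ℕd<d s m)) (h (residue m s))))
      (λ h r → h (+ toℕ r))
      (all? λ r → Q? (+ toℕ r))

  module _ (n m : ℕ) .{{_ : NonZero m}} where

    translate-cong : ∀ s (p : Point n m) → translate {n} (+ (s %ℕ m)) p ≡ translate {n} s p
    translate-cong s p = cong (combine (proj₁ (remQuot {n} m p)))
      (residue-cong m (+ toℕ (proj₂ (remQuot {n} m p))) s)

    ⊕-cong : ∀ (B : PointSet n m) s → _⊕_ {n} B (+ (s %ℕ m)) ≡ _⊕_ {n} B s
    ⊕-cong B s = tabulate-cong λ q →
      does-any-cong λ p → cong (λ p′ → does ((p ∈? B) ×-dec (p′ ≟ᶠ q))) (translate-cong s p)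
      where
      does-any-cong : ∀ {N} {P Q : Fin N → Set} {P? : Decidable P} {Q? : Decidable Q} →
                      (∀ i → does (P? i) ≡ does (Q? i)) → does (any? P?) ≡ does (any? Q?)
      does-any-cong {zero}  h = refl
      does-any-cong {suc N} h = cong₂ _∨_ (h zero) (does-any-cong (h ∘ suc))

    autoCorrelation? : Decidable (AutoCorrelation n m)
    autoCorrelation? B = allShifts? m
      (λ s → ¬? (m ℕ∣.∣? ℤ.∣ s ∣) →-dec (_ ℕₚ.≤? 2))
      (λ s h m∤s → subst (λ D → ∣ B ∩ D ∣ ≤ 2) (⊕-cong B s) (h (m∤s ∘ ∣%ℕ⇒∣ m s)))

    crossCorrelation? : ∀ A B → Dec (CrossCorrelation n m A B)
    crossCorrelation? A B = allShifts? m (λ s → _ ℕₚ.≤? 1)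
      (λ s → subst (λ D → ∣ A ∩ D ∣ ≤ 1) (⊕-cong B s))

    isOOC? : Decidable (IsOOC n m)
    isOOC? C = map′ (λ (u , w , a , c) → mkOOC u w a c)
      (λ o → let open IsOOC o in distinct , weight , auto , cross)
      (DecUnique.unique? _≟ˢ_ C
        ×-dec All.all? (λ B → ∣ B ∣ ℕₚ.≟ 3) C
        ×-dec All.all? autoCorrelation? C
        ×-dec All.all? (λ A → All.all? (λ B → ¬? (A ≟ˢ B) →-dec crossCorrelation? A B) C) C)

  isEquiDifferenceOOC? : (m : ℕ) .{{_ : NonZero m}} → Decidable (IsEquiDifferenceOOC m)
  isEquiDifferenceOOC? m C = map′ (λ (o , e) → mkEquiDifference o e)
    (λ d → let open IsEquiDifferenceOOC d in isOOC , equiDifference)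
    (isOOC? 1 m C ×-dec All.all? (λ B → any? λ a → B ≟ˢ progression m a) C)

------------------------------------------------------------------------

largestOOC : (n m : ℕ) .{{_ : NonZero m}} → ∃ (IsLargestSize (IsOOC n m))
largestOOC n m = largestSize (isOOC? n m) (mkOOC [] [] [] []) IsOOC.distinct

largestEquiDifferenceOOC : (m : ℕ) .{{_ : NonZero m}} →
                           ∃ (IsLargestSize (IsEquiDifferenceOOC m))
largestEquiDifferenceOOC m = largestSize (isEquiDifferenceOOC? m)
  (mkEquiDifference (mkOOC [] [] [] []) []) (IsOOC.distinct ∘ IsEquiDifferenceOOC.isOOC)

Φ : (n m : ℕ) .{{_ : NonZero m}} → ℕ
Φ n m = proj₁ (largestOOC n m)

Φ-isLargest : (n m : ℕ) .{{_ : NonZero m}} → IsLargestSize (IsOOC n m) (Φ n m)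
Φ-isLargest n m = proj₂ (largestOOC n m)

Ψᵉ : (m : ℕ) .{{_ : NonZero m}} → ℕ
Ψᵉ m = proj₁ (largestEquiDifferenceOOC m)

Ψᵉ-isLargest : (m : ℕ) .{{_ : NonZero m}} →
               IsLargestSize (IsEquiDifferenceOOC m) (Ψᵉ m)
Ψᵉ-isLargest m = proj₂ (largestEquiDifferenceOOC m)

{-# OPTIONS --safe #-}
-- Charge the six ordered pairs of points of each codeword to distinct translation
-- orbits of pairs. By the cross-correlation bound different codewords use different
-- orbits, and there are n (n m - 1) orbits of pairs of distinct points. Two ordered
-- pairs of one codeword share an orbit in two ways only. For {P, P + m/2} with m even,
-- the second pair is charged to the diagonal orbit of (P , P), otherwise unused. For an
-- equi-difference triple x, x + a, x + 2a in one row, the two excess pairs are charged to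
-- two extra slots of this codeword; the equi-difference codewords of a row, translated
-- to start at 0, form a 1-D equi-difference code, so 2 Ψᵉ(m) extra slots per row suffice.
-- This gives 6 |C| ≤ n (n m + 2 Ψᵉ(m)), and for odd m the n diagonal orbits remain free.
module Submission where

open import Defs
open import Data.Nat.Base using (ℕ; _+_; _*_; _∸_; _/_; _%_; _≤_; NonZero)
open import Data.Product.Base using (_×_)
open import Relation.Binary.PropositionalEquality using (_≡_)

open import Data.Bool.Base using (true; false)
import Data.Bool.Properties as Bool
open import Data.Fin.Base using (Fin; zero; suc; toℕ; combine; remQuot; join; splitAt; inject≤)
open import Data.Fin.Properties
  using (any?; toℕ-injective; toℕ-fromℕ<; toℕ<n; fromℕ<-cong; remQuot-combine; combine-remQuot;
         combine-injective; splitAt-join; inject≤-injective)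
  renaming (_≟_ to _≟ᶠ_; suc-injective to suc-injectiveᶠ)
open import Data.Fin.Subset using (Subset; ∣_∣; _∩_; _∪_; ⁅_⁆; _∈_; _-_)
open import Data.Fin.Subset.Properties
  using (_∈?_; x∈p⇒∣p-x∣<∣p∣; x∈p∧x≢y⇒x∈p-y; x∈p∩q⁺; x∈p∩q⁻; x∈p∪q⁺; x∈p∪q⁻; x∈⁅x⁆; x∈⁅y⁆⇒x≡y;
         p⊆q⇒∣p∣≤∣q∣; ∣⊤∣≡n; ∈⊤)
open import Data.Integer.Base as ℤ using (ℤ; +_; 0ℤ; _%ℕ_; _/ℕ_)
open import Data.Integer.Divisibility.Signed as ℤ∣ using () renaming (_∣_ to _∣ℤ_)
open import Data.Integer.DivMod using (n%ℕd<d; a≡a%ℕn+[a/ℕn]*n)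
import Data.Integer.Properties as ℤₚ
open import Data.Integer.Tactic.RingSolver using (solve-∀)
open import Data.List.Base
  using (List; []; _∷_; _++_; length; lookup; map; filter; tabulate; allFin)
open import Data.List.Properties using (length-map; length-++; length-tabulate)
open import Data.List.Membership.Propositional using () renaming (_∈_ to _∈ˡ_)
open import Data.List.Membership.Propositional.Properties
  using (∈-lookup; ∈-filter⁺; ∈-filter⁻; ∈-map⁻)
open import Data.List.Relation.Unary.All as All using (All; []; _∷_)
import Data.List.Relation.Unary.All.Properties as Allₚ
open import Data.List.Relation.Unary.AllPairs using ([]; _∷_)
open import Data.List.Relation.Unary.Any using (index; here; there)
open import Data.List.Relation.Unary.Any.Properties using (lookup-index)
open import Data.List.Relation.Unary.Unique.Propositional using (Unique)
import Data.List.Relation.Unary.Unique.Propositional.Properties as Uniqueₚ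
open import Data.Nat.Base using (zero; suc; _<_; _⊔_; z≤n; s≤s)
open import Data.Nat.Divisibility as ℕ∣ using (divides)
open import Data.Nat.DivMod using (m<n⇒m%n≡m; m*n/n≡m; /-monoˡ-≤; m*n%n≡0)
import Data.Nat.Properties as ℕₚ
open import Data.Product.Base using (∃; _,_; proj₁; proj₂)
open import Data.Product.Properties using (≡-dec)
open import Data.Sum.Base using (_⊎_; inj₁; inj₂)
open import Data.Sum.Properties using (inj₁-injective; inj₂-injective)
open import Data.Vec.Base using ([]; _∷_; here; there)
import Data.Vec.Properties as Vecₚ
open import Function.Base using (_∘_)
open import Relation.Binary.Definitions using (DecidableEquality)
open import Relation.Binary.PropositionalEquality
  using (refl; sym; trans; cong; cong₂; subst; subst₂; _≢_; module ≡-Reasoning)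
open import Relation.Nullary.Decidable using (yes; no; _×-dec_; dec-true; ¬?)
open import Relation.Nullary.Negation using (¬_; contradiction)
open import Relation.Unary using (Decidable)

-- Counting members of finite subsets.

unique⊆⇒length≤ : ∀ {N} {xs : List (Fin N)} (S : Subset N) →
                  Unique xs → All (_∈ S) xs → length xs ≤ ∣ S ∣
unique⊆⇒length≤ S [] [] = z≤n
unique⊆⇒length≤ S (x∉ ∷ u) (x∈ ∷ a) = ℕₚ.≤-<-trans
  (unique⊆⇒length≤ (S - _) u
    (All.zipWith (λ (x≢y , y∈S) → x∈p∧x≢y⇒x∈p-y y∈S (x≢y ∘ sym)) (x∉ , a)))
  (x∈p⇒∣p-x∣<∣p∣ x∈)

members : ∀ {N} (S : Subset N) → ∃ λ xs → Unique xs × All (_∈ S) xs × length xs ≡ ∣ S ∣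
members [] = [] , [] , [] , refl
members (b ∷ S) with members S
members (false ∷ S) | xs , u , a , e =
  map suc xs , Uniqueₚ.map⁺ suc-injectiveᶠ u , Allₚ.map⁺ (All.map there a) , trans (length-map suc xs) e
members (true ∷ S) | xs , u , a , e =
  zero ∷ map suc xs ,
  Allₚ.map⁺ (All.universal (λ _ ()) xs) ∷ Uniqueₚ.map⁺ suc-injectiveᶠ u ,
  here ∷ Allₚ.map⁺ (All.map there a) ,
  cong suc (trans (length-map suc xs) e)

injection⇒∣∣≤ : ∀ {M N} {S : Subset M} {T : Subset N} (f : Fin M → Fin N) →
                (∀ {x y} → f x ≡ f y → x ≡ y) → (∀ {x} → x ∈ S → f x ∈ T) → ∣ S ∣ ≤ ∣ T ∣
injection⇒∣∣≤ {S = S} {T} f inj f∈ with members S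
... | xs , u , a , e = subst (_≤ ∣ T ∣) (trans (length-map f xs) e)
  (unique⊆⇒length≤ T (Uniqueₚ.map⁺ inj u) (Allₚ.map⁺ (All.map f∈ a)))

-- Residues of integers modulo `m`.

module Residue (m : ℕ) .{{_ : NonZero m}} where

  residue-≡⇒∣ : ∀ a b → residue m a ≡ residue m b → + m ∣ℤ a ℤ.- b
  residue-≡⇒∣ a b e = ℤ∣.divides (a /ℕ m ℤ.- b /ℕ m) (begin
    a ℤ.- b
      ≡⟨ cong₂ ℤ._-_ (a≡a%ℕn+[a/ℕn]*n a m) (a≡a%ℕn+[a/ℕn]*n b m) ⟩
    (+ (a %ℕ m) ℤ.+ a /ℕ m ℤ.* + m) ℤ.- (+ (b %ℕ m) ℤ.+ b /ℕ m ℤ.* + m)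
      ≡⟨ cong (λ r → (+ r ℤ.+ a /ℕ m ℤ.* + m) ℤ.- (+ (b %ℕ m) ℤ.+ b /ℕ m ℤ.* + m)) r≡ ⟩
    (+ (b %ℕ m) ℤ.+ a /ℕ m ℤ.* + m) ℤ.- (+ (b %ℕ m) ℤ.+ b /ℕ m ℤ.* + m)
      ≡⟨ rearrange (+ (b %ℕ m)) (a /ℕ m) (b /ℕ m) (+ m) ⟩
    (a /ℕ m ℤ.- b /ℕ m) ℤ.* + m ∎)
    where
    open ≡-Reasoning
    r≡ : a %ℕ m ≡ b %ℕ m
    r≡ = trans (sym (toℕ-fromℕ< (n%ℕd<d a m))) (trans (cong toℕ e) (toℕ-fromℕ< (n%ℕd<d b m)))
    rearrange : ∀ r q q′ k → (r ℤ.+ q ℤ.* k) ℤ.- (r ℤ.+ q′ ℤ.* k) ≡ (q ℤ.- q′) ℤ.* k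
    rearrange = solve-∀

  -- The two remainders differ by a multiple of `m` that is smaller than `m` in absolute value,
  -- hence by `0`.
  ∣⇒residue-≡ : ∀ a b → + m ∣ℤ a ℤ.- b → residue m a ≡ residue m b
  ∣⇒residue-≡ a b (ℤ∣.divides k e) = fromℕ<-cong _ _
    (ℤₚ.+-injective (ℤₚ.i-j≡0⇒i≡j _ _ (ℤₚ.∣i∣≡0⇒i≡0 (small ∣d∣<m (ℤ∣.∣⇒∣ᵤ m∣d))))) _ _
    where
    open ≡-Reasoning
    r = a %ℕ m
    s = b %ℕ m
    rearrange : ∀ r s q q′ k → r ℤ.- s ≡ (r ℤ.+ q ℤ.* k) ℤ.- (s ℤ.+ q′ ℤ.* k) ℤ.+ (q′ ℤ.- q) ℤ.* k
    rearrange = solve-∀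
    collect : ∀ k d q → k ℤ.* d ℤ.+ q ℤ.* d ≡ (k ℤ.+ q) ℤ.* d
    collect = solve-∀
    m∣d : + m ∣ℤ + r ℤ.- + s
    m∣d = ℤ∣.divides (k ℤ.+ (b /ℕ m ℤ.- a /ℕ m)) (begin
      + r ℤ.- + s
        ≡⟨ rearrange (+ r) (+ s) (a /ℕ m) (b /ℕ m) (+ m) ⟩
      (+ r ℤ.+ a /ℕ m ℤ.* + m) ℤ.- (+ s ℤ.+ b /ℕ m ℤ.* + m) ℤ.+ (b /ℕ m ℤ.- a /ℕ m) ℤ.* + m
        ≡⟨ cong₂ (λ x y → x ℤ.- y ℤ.+ (b /ℕ m ℤ.- a /ℕ m) ℤ.* + m)
             (a≡a%ℕn+[a/ℕn]*n a m) (a≡a%ℕn+[a/ℕn]*n b m) ⟨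
      a ℤ.- b ℤ.+ (b /ℕ m ℤ.- a /ℕ m) ℤ.* + m
        ≡⟨ cong (ℤ._+ (b /ℕ m ℤ.- a /ℕ m) ℤ.* + m) e ⟩
      k ℤ.* + m ℤ.+ (b /ℕ m ℤ.- a /ℕ m) ℤ.* + m
        ≡⟨ collect k (+ m) _ ⟩
      (k ℤ.+ (b /ℕ m ℤ.- a /ℕ m)) ℤ.* + m ∎)
    ∣d∣<m : ℤ.∣ + r ℤ.- + s ∣ < m
    ∣d∣<m = ℕₚ.≤-<-trans
      (subst (λ z → ℤ.∣ z ∣ ≤ r ⊔ s) (sym (ℤₚ.m-n≡m⊖n r s)) (ℤₚ.∣m⊝n∣≤m⊔n r s))
      (ℕₚ.⊔-lub (n%ℕd<d a m) (n%ℕd<d b m))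
    small : ∀ {k} → k < m → m ℕ∣.∣ k → k ≡ 0
    small {zero}  _   _   = refl
    small {suc k} k<m m∣k = contradiction m∣k (ℕ∣.>⇒∤ k<m)

  residue-toℕ : ∀ (x : Fin m) → residue m (+ toℕ x) ≡ x
  residue-toℕ x = toℕ-injective (trans (toℕ-fromℕ< _) (m<n⇒m%n≡m (toℕ<n x)))

  toℕ-residue : ∀ z → + m ∣ℤ + toℕ (residue m z) ℤ.- z
  toℕ-residue z = residue-≡⇒∣ (+ toℕ (residue m z)) z (residue-toℕ (residue m z))

-- The translation action on points.

module Translation (n m : ℕ) .{{_ : NonZero m}} where
  open Residue m public

  opaque
    row : Point n m → Fin n
    row p = proj₁ (remQuot {n} m p)

    -- Columns are integers, compared through divisibility of differences by `m`; relations between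
    -- columns then reduce to ring identities.
    col : Point n m → ℤ
    col p = + toℕ (proj₂ (remQuot {n} m p))

    infixr 7 _⊹_
    _⊹_ : ℤ → Point n m → Point n m
    s ⊹ p = translate {n} {m} s p

    col-combine : ∀ i z → + m ∣ℤ col (combine {n} i (residue m z)) ℤ.- z
    col-combine i z = subst (λ x → + m ∣ℤ + toℕ x ℤ.- z)
      (sym (cong proj₂ (remQuot-combine {n} i (residue m z)))) (toℕ-residue z)

    row-⊹ : ∀ s p → row (s ⊹ p) ≡ row p
    row-⊹ s p = cong proj₁ (remQuot-combine {n} (row p) _)

    col-⊹ : ∀ s p → + m ∣ℤ col (s ⊹ p) ℤ.- (col p ℤ.+ s)
    col-⊹ s p = col-combine (row p) (col p ℤ.+ s)

    point-≡ : ∀ p q → row p ≡ row q → + m ∣ℤ col p ℤ.- col q → p ≡ q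
    point-≡ p q re ce = begin
      p                                           ≡⟨ combine-remQuot {n} m p ⟨
      combine (row p) (proj₂ (remQuot {n} m p))   ≡⟨ cong₂ combine re x≡y ⟩
      combine (row q) (proj₂ (remQuot {n} m q))   ≡⟨ combine-remQuot {n} m q ⟩
      q                                           ∎
      where
      open ≡-Reasoning
      x≡y : proj₂ (remQuot {n} m p) ≡ proj₂ (remQuot {n} m q)
      x≡y = trans (sym (residue-toℕ _)) (trans (∣⇒residue-≡ (col p) (col q) ce) (residue-toℕ _))

    ⊹-cong : ∀ s t p → + m ∣ℤ s ℤ.- t → s ⊹ p ≡ t ⊹ p
    ⊹-cong s t p d = cong (combine (row p)) (∣⇒residue-≡ (col p ℤ.+ s) (col p ℤ.+ t)
      (subst (+ m ∣ℤ_) (sym (cancel (col p) s t)) d))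
      where
      cancel : ∀ c s t → (c ℤ.+ s) ℤ.- (c ℤ.+ t) ≡ s ℤ.- t
      cancel = solve-∀

    ⊹-cancel : ∀ s t p → s ⊹ p ≡ t ⊹ p → + m ∣ℤ s ℤ.- t
    ⊹-cancel s t p e = subst (+ m ∣ℤ_) (cancel (col p) s t)
      (residue-≡⇒∣ (col p ℤ.+ s) (col p ℤ.+ t) (proj₂ (combine-injective {n} {m} (row p) _ (row p) _ e)))
      where
      cancel : ∀ c s t → (c ℤ.+ s) ℤ.- (c ℤ.+ t) ≡ s ℤ.- t
      cancel = solve-∀

    ⊹-∘ : ∀ s t p → t ⊹ s ⊹ p ≡ (s ℤ.+ t) ⊹ p
    ⊹-∘ s t p = cong₂ combine (row-⊹ s p) (∣⇒residue-≡ (col (s ⊹ p) ℤ.+ t) (col p ℤ.+ (s ℤ.+ t))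
      (subst (+ m ∣ℤ_) (rearrange (col (s ⊹ p)) (col p) s t) (col-⊹ s p)))
      where
      rearrange : ∀ d c s t → d ℤ.- (c ℤ.+ s) ≡ (d ℤ.+ t) ℤ.- (c ℤ.+ (s ℤ.+ t))
      rearrange = solve-∀

    ⊹-identity : ∀ p → 0ℤ ⊹ p ≡ p
    ⊹-identity p = point-≡ _ p (row-⊹ 0ℤ p)
      (subst (λ c → + m ∣ℤ col (0ℤ ⊹ p) ℤ.- c) (ℤₚ.+-identityʳ (col p)) (col-⊹ 0ℤ p))

    ⊹-injective : ∀ s {p q} → s ⊹ p ≡ s ⊹ q → p ≡ q
    ⊹-injective s {p} {q} e = trans (sym (undo p)) (trans (cong (ℤ.- s ⊹_) e) (undo q))
      where
      undo : ∀ p → (ℤ.- s) ⊹ s ⊹ p ≡ p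
      undo p = trans (⊹-∘ s (ℤ.- s) p) (trans (cong (_⊹ p) (ℤₚ.+-inverseʳ s)) (⊹-identity p))

    ⊹-transport : ∀ p q → row p ≡ row q → (col q ℤ.- col p) ⊹ p ≡ q
    ⊹-transport p q e = point-≡ _ q (trans (row-⊹ (col q ℤ.- col p) p) e)
      (subst (λ c → + m ∣ℤ col ((col q ℤ.- col p) ⊹ p) ℤ.- c) (rearrange (col p) (col q)) (col-⊹ (col q ℤ.- col p) p))
      where
      rearrange : ∀ c d → c ℤ.+ (d ℤ.- c) ≡ d
      rearrange = solve-∀

    ∈-⊕⁺ : ∀ {B} s {p q} → p ∈ B → s ⊹ p ≡ q → q ∈ _⊕_ {n} {m} B s
    ∈-⊕⁺ {B} s {p} {q} p∈B e = Vecₚ.lookup⇒[]= q _ (trans (Vecₚ.lookup∘tabulate _ q)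
      (dec-true (any? λ p → (p ∈? B) ×-dec ((s ⊹ p) ≟ᶠ q)) (p , p∈B , e)))

    ∈-⊕⁻ : ∀ B s {q} → q ∈ _⊕_ {n} {m} B s → ∃ λ p → p ∈ B × s ⊹ p ≡ q
    ∈-⊕⁻ B s {q} q∈ with any? (λ p → (p ∈? B) ×-dec ((s ⊹ p) ≟ᶠ q)) | trans (sym (Vecₚ.lookup∘tabulate _ q)) (Vecₚ.[]=⇒lookup q∈)
    ... | yes w | _  = w
    ... | no _  | ()

-- Translation orbits of ordered pairs.

m∣k+k⇒k+k≡m : ∀ {m k} → k ≢ 0 → k < m → m ℕ∣.∣ k + k → k + k ≡ m
m∣k+k⇒k+k≡m k≢0 k<m (divides 0 e) = contradiction (ℕₚ.m+n≡0⇒m≡0 _ e) k≢0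
m∣k+k⇒k+k≡m k≢0 k<m (divides 1 e) = trans e (ℕₚ.*-identityˡ _)
-- A quotient of at least two would give `m + m ≤ k + k`, against `k < m`.
m∣k+k⇒k+k≡m {m} {k} k≢0 k<m (divides (suc (suc q)) e) = contradiction
  (ℕₚ.<-≤-trans (ℕₚ.+-mono-< k<m k<m) (begin
    m + m             ≤⟨ ℕₚ.+-monoʳ-≤ m (ℕₚ.m≤m+n m (q * m)) ⟩
    m + (m + q * m)   ≡⟨ e ⟨
    k + k             ∎))
  (ℕₚ.<-irrefl refl)
  where open ℕₚ.≤-Reasoning

module Orbits (n m : ℕ) .{{_ : NonZero m}} where
  open Translation n m public

  δ : Point n m → Point n m → ℤ
  δ p q = col q ℤ.- col p

  Orbit : Set
  Orbit = Fin n × Fin n × Fin m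

  -- The orbit under translation of the ordered pair (p , q).
  opaque
    orbit : Point n m → Point n m → Orbit
    orbit p q = row p , row q , residue m (δ p q)

  _≟ᵒ_ : DecidableEquality Orbit
  _≟ᵒ_ = ≡-dec _≟ᶠ_ (≡-dec _≟ᶠ_ _≟ᶠ_)

  opaque
    unfolding orbit

    orbit-def : ∀ p q → orbit p q ≡ (row p , row q , residue m (δ p q))
    orbit-def p q = refl

  orbit-≡ : ∀ p q p′ q′ → row p ≡ row p′ → row q ≡ row q′ →
            + m ∣ℤ δ p q ℤ.- δ p′ q′ → orbit p q ≡ orbit p′ q′
  orbit-≡ p q p′ q′ r r′ d = trans (orbit-def p q)
    (trans (cong₂ _,_ r (cong₂ _,_ r′ (∣⇒residue-≡ (δ p q) (δ p′ q′) d))) (sym (orbit-def p′ q′)))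

  module _ p q p′ q′ (e : orbit p q ≡ orbit p′ q′) where
    private
      components : (row p , row q , residue m (δ p q)) ≡ (row p′ , row q′ , residue m (δ p′ q′))
      components = trans (sym (orbit-def p q)) (trans e (orbit-def p′ q′))

    orbit-rowˡ : row p ≡ row p′
    orbit-rowˡ = cong proj₁ components

    orbit-rowʳ : row q ≡ row q′
    orbit-rowʳ = cong (λ x → proj₁ (proj₂ x)) components

    orbit-δ : + m ∣ℤ δ p q ℤ.- δ p′ q′
    orbit-δ = residue-≡⇒∣ (δ p q) (δ p′ q′) (cong (λ x → proj₂ (proj₂ x)) components)

    -- The shift carrying `p` to `p′` also carries `q` to `q′`, because the two column differences
    -- agree modulo `m`. It turns an equality of orbits into a shift to which the correlation
    -- conditions apply.
    orbit-translation : ∃ λ t → t ⊹ p ≡ p′ × t ⊹ q ≡ q′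
    orbit-translation = δ p p′ , ⊹-transport p p′ orbit-rowˡ ,
      trans (⊹-cong (δ p p′) (δ q q′) q
        (subst (+ m ∣ℤ_) (rearrange (col p) (col q) (col p′) (col q′)) orbit-δ))
        (⊹-transport q q′ orbit-rowʳ)
      where
      rearrange : ∀ a b c d → (b ℤ.- a) ℤ.- (d ℤ.- c) ≡ (c ℤ.- a) ℤ.- (d ℤ.- b)
      rearrange = solve-∀

    orbit-swap : orbit q p ≡ orbit q′ p′
    orbit-swap = orbit-≡ q p q′ p′ orbit-rowʳ orbit-rowˡ
      (subst (+ m ∣ℤ_) (rearrange (col p) (col q) (col p′) (col q′)) (ℤ∣.∣m⇒∣-m orbit-δ))
      where
      rearrange : ∀ a b c d → ℤ.- ((b ℤ.- a) ℤ.- (d ℤ.- c)) ≡ (a ℤ.- b) ℤ.- (c ℤ.- d)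
      rearrange = solve-∀

  orbit-cancelˡ : ∀ p q q′ → orbit p q ≡ orbit p q′ → q ≡ q′
  orbit-cancelˡ p q q′ e = point-≡ q q′ (orbit-rowʳ p q p q′ e)
    (subst (+ m ∣ℤ_) (rearrange (col p) (col q) (col q′)) (orbit-δ p q p q′ e))
    where
    rearrange : ∀ a b c → (b ℤ.- a) ℤ.- (c ℤ.- a) ≡ b ℤ.- c
    rearrange = solve-∀

  orbit-cancelʳ : ∀ p p′ q → orbit p q ≡ orbit p′ q → p ≡ p′
  orbit-cancelʳ p p′ q e = orbit-cancelˡ q p p′ (orbit-swap p q p′ q e)

  -- One shift sends both `p` and `q` to `r`, and shifts are injective. Pairs of distinct points
  -- therefore leave all diagonal orbits free.
  orbit-diagonal : ∀ p q r → orbit p q ≡ orbit r r → p ≡ q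
  orbit-diagonal p q r e with orbit-translation p q r r e
  ... | t , tp , tq = ⊹-injective t (trans tp (sym tq))

  module _ p q (p≢q : p ≢ q) (e : orbit p q ≡ orbit q p) where
    private d = toℕ (residue m (δ p q))

    -- Swapping the points negates their difference, so `m` divides twice the difference and hence
    -- `d + d`. The residue `d` is nonzero because `p` and `q` are distinct points of one row.
    half-period : d + d ≡ m
    half-period = m∣k+k⇒k+k≡m d≢0 (toℕ<n (residue m (δ p q)))
      (ℤ∣.∣⇒∣ᵤ (subst (+ m ∣ℤ_) (double (+ d) (col p) (col q))
        (ℤ∣.∣m∣n⇒∣m+n (orbit-δ p q q p e)
          (ℤ∣.∣n⇒∣m*n (+ 2) (toℕ-residue (δ p q))))))
      where
      double : ∀ d a b → ((b ℤ.- a) ℤ.- (a ℤ.- b)) ℤ.+ + 2 ℤ.* (d ℤ.- (b ℤ.- a)) ≡ d ℤ.+ d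
      double = solve-∀
      d≢0 : d ≢ 0
      d≢0 d≡0 = p≢q (point-≡ p q (orbit-rowˡ p q q p e)
        (subst (+ m ∣ℤ_) (trans (cong (λ x → + x ℤ.- δ p q) d≡0) (negate (col p) (col q)))
          (toℕ-residue (δ p q))))
        where
        negate : ∀ a b → 0ℤ ℤ.- (b ℤ.- a) ≡ a ℤ.- b
        negate = solve-∀

  -- By `half-period` both differences have residue `m / 2`, so a row has at most one such orbit.
  -- The diagonal orbit of the row can thus stand in for it without ambiguity.
  half-orbit-unique : ∀ p q p′ q′ → p ≢ q → orbit p q ≡ orbit q p →
                      p′ ≢ q′ → orbit p′ q′ ≡ orbit q′ p′ → row p ≡ row p′ →
                      orbit p q ≡ orbit p′ q′
  half-orbit-unique p q p′ q′ p≢q e p′≢q′ e′ r = orbit-≡ p q p′ q′ r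
    (trans (sym (orbit-rowˡ p q q p e)) (trans r (orbit-rowˡ p′ q′ q′ p′ e′)))
    (residue-≡⇒∣ (δ p q) (δ p′ q′)
      (toℕ-injective (halve (trans (half-period p q p≢q e) (sym (half-period p′ q′ p′≢q′ e′))))))
    where
    halve : ∀ {a b} → a + a ≡ b + b → a ≡ b
    halve {a} {b} h = ℕₚ.*-cancelˡ-≡ a b 2
      (trans (cong (_+_ a) (ℕₚ.+-identityʳ a)) (trans h (cong (_+_ b) (sym (ℕₚ.+-identityʳ b)))))

  -- The orbit charged to (q , p) once orbit p q is charged to (p , q): when the
  -- two coincide, the otherwise unused diagonal orbit stands in for the second copy.
  data Reverse (p q : Point n m) : Orbit → Set where
    generic : orbit p q ≢ orbit q p → Reverse p q (orbit q p)
    half    : orbit p q ≡ orbit q p → Reverse p q (orbit p p)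

  reverse : ∀ p q → ∃ (Reverse p q)
  reverse p q with orbit p q ≟ᵒ orbit q p
  ... | yes e = orbit p p , half e
  ... | no ¬e = orbit q p , generic ¬e

  reverse-≢ : ∀ {p q o} → p ≢ q → Reverse p q o → orbit p q ≢ o
  reverse-≢ p≢q (generic ¬e) = ¬e
  reverse-≢ {p} {q} p≢q (half _) e = p≢q (orbit-diagonal p q p e)

  -- `f` stands for the orbit of a pair itself (forward) and `b` for the one charged to its reversal
  -- (backward); the first letter concerns the first pair.
  record Disjoint (o₁ o₁′ o₂ o₂′ : Orbit) : Set where
    field
      ff : o₁ ≢ o₂
      fb : o₁ ≢ o₂′
      bf : o₁′ ≢ o₂
      bb : o₁′ ≢ o₂′

  -- As the pairs meet in `q`, a coincidence of one pair with the reversal of the other cancels to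
  -- `p ≡ r`. Only the equality of the two forward orbits has to be excluded by hypothesis.
  adjacent-disjoint : ∀ {p q r o o′} → p ≢ q → q ≢ r → p ≢ r → orbit p q ≢ orbit q r →
                      Reverse p q o → Reverse q r o′ → Disjoint (orbit p q) o (orbit q r) o′
  adjacent-disjoint {p} {q} {r} p≢q q≢r p≢r ne v w = record
    { ff = ne ; fb = fb w ; bf = bf v ; bb = bb v w }
    where
    fb : ∀ {o′} → Reverse q r o′ → orbit p q ≢ o′
    fb (generic _) e = p≢r (orbit-cancelʳ p r q e)
    fb (half _) e = p≢q (orbit-diagonal p q q e)
    bf : ∀ {o} → Reverse p q o → o ≢ orbit q r
    bf (generic _) e = p≢r (orbit-cancelˡ q p r e)
    bf (half _) e = q≢r (orbit-diagonal q r p (sym e))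
    bb : ∀ {o o′} → Reverse p q o → Reverse q r o′ → o ≢ o′
    bb (generic _) (generic _) e = ne (orbit-swap q p r q e)
    bb (generic _) (half _) e = p≢q (sym (orbit-diagonal q p q e))
    bb (half _) (generic _) e = q≢r (sym (orbit-diagonal r q p (sym e)))
    -- Equal diagonal orbits put both pairs in one row, whose half orbit is unique.
    bb (half h) (half h′) e = ne (half-orbit-unique p q q r p≢q h q≢r h′ (orbit-rowˡ p p q q e))

-- Equi-difference codewords of one row as a 1-D code.

lookup-injective : ∀ {A : Set} {xs : List A} → Unique xs →
                   ∀ i j → lookup xs i ≡ lookup xs j → i ≡ j
lookup-injective (_ ∷ _)  zero    zero    _ = refl
lookup-injective (x∉ ∷ _) zero    (suc j) e = contradiction e (All.lookup x∉ (∈-lookup j))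
lookup-injective (x∉ ∷ _) (suc i) zero    e = contradiction (sym e) (All.lookup x∉ (∈-lookup i))
lookup-injective (_ ∷ u)  (suc i) (suc j) e = cong suc (lookup-injective u i j e)

module EquiDifference (n m : ℕ) .{{_ : NonZero m}} where
  open Translation n m
  module T₁ = Translation 1 m

  point : ℤ → Point 1 m
  point z = combine {1} zero (residue m z)

  -- Identifies `Z_m` with the row of `P`, with `0` placed at `P`.
  embed : Point n m → Point 1 m → Point n m
  embed P p = T₁.col p ⊹ P

  embed-point : ∀ P z → embed P (point z) ≡ z ⊹ P
  embed-point P z = ⊹-cong (T₁.col (point z)) z P (T₁.col-combine zero z)

  embed-injective : ∀ P {p q} → embed P p ≡ embed P q → p ≡ q
  embed-injective P {p} {q} e = T₁.point-≡ p q (Fin1-≡ _ _) (⊹-cancel (T₁.col p) (T₁.col q) P e)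
    where
    Fin1-≡ : ∀ (i j : Fin 1) → i ≡ j
    Fin1-≡ zero zero = refl

  embed-⊹ : ∀ P s p → embed P (s T₁.⊹ p) ≡ s ⊹ embed P p
  embed-⊹ P s p = trans (⊹-cong _ _ P (T₁.col-⊹ s p)) (sym (⊹-∘ (T₁.col p) s P))

  -- The base points differ by `t`, so shifting the normalised words by `s` relative to each other
  -- corresponds to shifting the original ones by `t + s`. Correlation bounds thereby pass from the
  -- original words to the normalised ones.
  embed-⊕ : ∀ {A′ B′ : PointSet 1 m} {A B : PointSet n m} {P P′} s t → t ⊹ P′ ≡ P →
            (∀ {p} → p ∈ A′ → embed P p ∈ A) → (∀ {p} → p ∈ B′ → embed P′ p ∈ B) →
            ∣ A′ ∩ (_⊕_ {1} {m} B′ s) ∣ ≤ ∣ A ∩ (_⊕_ {n} {m} B (t ℤ.+ s)) ∣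
  embed-⊕ {A′} {B′} {A} {B} {P} {P′} s t tP′≡P A′⇒A B′⇒B =
    injection⇒∣∣≤ (embed P) (embed-injective P) image
    where
    open ≡-Reasoning
    image : ∀ {q} → q ∈ A′ ∩ (_⊕_ {1} {m} B′ s) → embed P q ∈ A ∩ (_⊕_ {n} {m} B (t ℤ.+ s))
    image {q} q∈ with x∈p∩q⁻ A′ _ q∈
    ... | q∈A′ , q∈B′⊕s with T₁.∈-⊕⁻ B′ s q∈B′⊕s
    ... | p , p∈B′ , sp≡q = x∈p∩q⁺ (A′⇒A q∈A′ , ∈-⊕⁺ (t ℤ.+ s) (B′⇒B p∈B′) (begin
      (t ℤ.+ s) ⊹ embed P′ p             ≡⟨ ⊹-∘ (T₁.col p) (t ℤ.+ s) P′ ⟩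
      (T₁.col p ℤ.+ (t ℤ.+ s)) ⊹ P′      ≡⟨ cong (_⊹ P′) (rearrange (T₁.col p) s t) ⟩
      (t ℤ.+ (T₁.col p ℤ.+ s)) ⊹ P′      ≡⟨ ⊹-∘ t (T₁.col p ℤ.+ s) P′ ⟨
      (T₁.col p ℤ.+ s) ⊹ t ⊹ P′          ≡⟨ cong ((T₁.col p ℤ.+ s) ⊹_) tP′≡P ⟩
      (T₁.col p ℤ.+ s) ⊹ P               ≡⟨ ⊹-∘ (T₁.col p) s P ⟨
      s ⊹ embed P p                      ≡⟨ embed-⊹ P s p ⟨
      embed P (s T₁.⊹ p)                 ≡⟨ cong (embed P) sp≡q ⟩
      embed P q                          ∎))
      where
      rearrange : ∀ c s t → c ℤ.+ (t ℤ.+ s) ≡ t ℤ.+ (c ℤ.+ s)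
      rearrange = solve-∀

  IsProgression : PointSet n m → Point n m → Fin m → Set
  IsProgression B P a = P ∈ B × (+ toℕ a ⊹ P) ∈ B × ((+ 2 ℤ.* + toℕ a) ⊹ P) ∈ B ×
    P ≢ + toℕ a ⊹ P × P ≢ (+ 2 ℤ.* + toℕ a) ⊹ P

  EquiDiff : Fin n → PointSet n m → Set
  EquiDiff i B = ∃ λ P → row P ≡ i × ∃ (IsProgression B P)

  equiDiff? : ∀ i → Decidable (EquiDiff i)
  equiDiff? i B = any? λ P → (row P ≟ᶠ i) ×-dec any? λ a →
    (P ∈? B) ×-dec ((+ toℕ a ⊹ P) ∈? B) ×-dec (((+ 2 ℤ.* + toℕ a) ⊹ P) ∈? B) ×-dec
    ¬? (P ≟ᶠ (+ toℕ a ⊹ P)) ×-dec ¬? (P ≟ᶠ ((+ 2 ℤ.* + toℕ a) ⊹ P))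

  module _ {B P a} (prog : IsProgression B P a) where
    private
      0∈  = proj₁ prog
      a∈  = proj₁ (proj₂ prog)
      2a∈ = proj₁ (proj₂ (proj₂ prog))
      0≢a = proj₁ (proj₂ (proj₂ (proj₂ prog)))
      0≢2a = proj₂ (proj₂ (proj₂ (proj₂ prog)))
      ⟨0⟩ ⟨a⟩ ⟨2a⟩ : Point 1 m
      ⟨0⟩ = point 0ℤ
      ⟨a⟩ = point (+ toℕ a)
      ⟨2a⟩ = point (+ 2 ℤ.* + toℕ a)

    embed-progression : ∀ {p} → p ∈ progression m a → embed P p ∈ B
    embed-progression p∈ with x∈p∪q⁻ ⁅ ⟨0⟩ ⁆ (⁅ ⟨a⟩ ⁆ ∪ ⁅ ⟨2a⟩ ⁆) p∈
    ... | inj₁ p∈0 rewrite x∈⁅y⁆⇒x≡y ⟨0⟩ p∈0 =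
      subst (_∈ B) (sym (trans (embed-point P 0ℤ) (⊹-identity P))) 0∈
    ... | inj₂ p∈a∪2a with x∈p∪q⁻ ⁅ ⟨a⟩ ⁆ ⁅ ⟨2a⟩ ⁆ p∈a∪2a
    ... | inj₁ p∈a rewrite x∈⁅y⁆⇒x≡y ⟨a⟩ p∈a =
      subst (_∈ B) (sym (embed-point P (+ toℕ a))) a∈
    ... | inj₂ p∈2a rewrite x∈⁅y⁆⇒x≡y ⟨2a⟩ p∈2a =
      subst (_∈ B) (sym (embed-point P (+ 2 ℤ.* + toℕ a))) 2a∈

    -- `embed P` maps the progression injectively into `B`, which gives at most three points; its
    -- three listed points are distinct because their images are.
    ∣progression∣ : ∣ B ∣ ≡ 3 → ∣ progression m a ∣ ≡ 3
    ∣progression∣ w = ℕₚ.≤-antisym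
      (subst (∣ progression m a ∣ ≤_) w (injection⇒∣∣≤ (embed P) (embed-injective P) embed-progression))
      (unique⊆⇒length≤ (progression m a)
        ((point-≢ 0ℤ (+ toℕ a) (0≢a ∘ trans (sym (⊹-identity P)))
        ∷ point-≢ 0ℤ (+ 2 ℤ.* + toℕ a) (0≢2a ∘ trans (sym (⊹-identity P))) ∷ [])
        ∷ (point-≢ (+ toℕ a) (+ 2 ℤ.* + toℕ a) a≢2a ∷ []) ∷ [] ∷ [])
        (x∈p∪q⁺ (inj₁ (x∈⁅x⁆ ⟨0⟩))
        ∷ x∈p∪q⁺ {p = ⁅ ⟨0⟩ ⁆} (inj₂ (x∈p∪q⁺ (inj₁ (x∈⁅x⁆ ⟨a⟩))))
        ∷ x∈p∪q⁺ {p = ⁅ ⟨0⟩ ⁆} (inj₂ (x∈p∪q⁺ {p = ⁅ ⟨a⟩ ⁆} (inj₂ (x∈⁅x⁆ ⟨2a⟩)))) ∷ []))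
      where
      point-≢ : ∀ y z → y ⊹ P ≢ z ⊹ P → point y ≢ point z
      point-≢ y z ne e = ne (trans (sym (embed-point P y)) (trans (cong (embed P) e) (embed-point P z)))
      a≢2a : + toℕ a ⊹ P ≢ (+ 2 ℤ.* + toℕ a) ⊹ P
      a≢2a e = 0≢a (⊹-injective (+ toℕ a) (trans e (trans (cong (_⊹ P) (double (+ toℕ a)))
        (sym (⊹-∘ (+ toℕ a) (+ toℕ a) P)))))
        where
        double : ∀ z → + 2 ℤ.* z ≡ z ℤ.+ z
        double = solve-∀

  module _ {C : List (PointSet n m)} (ooc : IsOOC n m C) (i : Fin n) where
    open IsOOC ooc

    -- Translating each word so that its base point becomes `0` yields an equi-difference 1-D code
    -- with as many codewords, to which the maximality of `Ψᵉ m` applies.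
    equiDiff-length≤Ψᵉ : (E : List (PointSet n m)) → Unique E → All (_∈ˡ C) E →
                         All (EquiDiff i) E → length E ≤ Ψᵉ m
    equiDiff-length≤Ψᵉ E unique E⊆C equi = subst (_≤ Ψᵉ m) (length-tabulate code)
      (proj₂ (Ψᵉ-isLargest m) (tabulate code) (mkEquiDifference
        (mkOOC (Uniqueₚ.tabulate⁺ code-injective) (Allₚ.tabulate⁺ code-weight)
          (Allₚ.tabulate⁺ code-auto)
          (Allₚ.tabulate⁺ λ k → Allₚ.tabulate⁺ λ l A≢B → code-cross k l (A≢B ∘ cong code)))
        (Allₚ.tabulate⁺ λ k → step k , refl)))
      where
      B : Fin (length E) → PointSet n m
      B = lookup E
      B∈C : ∀ k → B k ∈ˡ C
      B∈C k = All.lookup E⊆C (∈-lookup k)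
      equiB : ∀ k → EquiDiff i (B k)
      equiB k = All.lookup equi (∈-lookup k)
      base : Fin (length E) → Point n m
      base k = proj₁ (equiB k)
      row-base : ∀ k → row (base k) ≡ i
      row-base k = proj₁ (proj₂ (equiB k))
      step : Fin (length E) → Fin m
      step k = proj₁ (proj₂ (proj₂ (equiB k)))
      prog : ∀ k → IsProgression (B k) (base k) (step k)
      prog k = proj₂ (proj₂ (proj₂ (equiB k)))
      code : Fin (length E) → PointSet 1 m
      code k = progression m (step k)
      code-weight : ∀ k → ∣ code k ∣ ≡ 3
      code-weight k = ∣progression∣ (prog k) (All.lookup weight (B∈C k))
      code-auto : ∀ k → AutoCorrelation 1 m (code k)
      code-auto k s m∤s = ℕₚ.≤-trans
        (embed-⊕ s 0ℤ (⊹-identity (base k)) (embed-progression (prog k)) (embed-progression (prog k)))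
        (subst (λ z → ∣ B k ∩ (_⊕_ {n} {m} (B k) z) ∣ ≤ 2) (sym (ℤₚ.+-identityˡ s))
          (All.lookup auto (B∈C k) s m∤s))
      -- Assumes different indices rather than different normalised words, so that `code-injective`
      -- can be derived from it.
      code-cross : ∀ k l → k ≢ l → CrossCorrelation 1 m (code k) (code l)
      code-cross k l k≢l s = ℕₚ.≤-trans
        (embed-⊕ s (col (base k) ℤ.- col (base l))
          (⊹-transport (base l) (base k) (trans (row-base l) (sym (row-base k))))
          (embed-progression (prog k)) (embed-progression (prog l)))
        (All.lookup (All.lookup cross (B∈C k)) (B∈C l) (k≢l ∘ lookup-injective unique k l)
          (col (base k) ℤ.- col (base l) ℤ.+ s))
      code-injective : ∀ {k l} → code k ≡ code l → k ≡ l
      code-injective {k} {l} e with k ≟ᶠ l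
      ... | yes k≡l = k≡l
      -- Equal normalised words would share three points at shift `0`, where `code-cross` allows
      -- one.
      ... | no k≢l = contradiction (ℕₚ.≤-trans
        (subst (_≤ ∣ code k ∩ (_⊕_ {1} {m} (code l) 0ℤ) ∣) (code-weight k)
          (p⊆q⇒∣p∣≤∣q∣ λ {p} p∈ → x∈p∩q⁺ (p∈ , T₁.∈-⊕⁺ 0ℤ (subst (p ∈_) e p∈) (T₁.⊹-identity p))))
        (code-cross k l k≢l 0ℤ)) λ { (s≤s ()) }

-- Assembling the charges of single codewords.

module _ {A S : Set} {Charged : A → S → Set} where

  collect : (k : ℕ) {xs : List A} → Unique xs →
    (∀ {x} → x ∈ˡ xs → ∃ λ ss → Unique ss × length ss ≡ k × All (Charged x) ss) →
    (∀ {x y s} → x ∈ˡ xs → y ∈ˡ xs → Charged x s → Charged y s → x ≡ y) →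
    ∃ λ ss → Unique ss × length ss ≡ length xs * k × All (λ s → ∃ λ x → x ∈ˡ xs × Charged x s) ss
  collect k {[]} _ _ _ = [] , [] , refl , []
  collect k {x ∷ xs} (x∉ ∷ u) charge disjoint
    with charge (here refl)
       | collect k u (charge ∘ there) (λ y∈ z∈ → disjoint (there y∈) (there z∈))
  ... | ss , uss , lss , css | ts , uts , lts , cts =
    ss ++ ts ,
    Uniqueₚ.++⁺ uss uts (λ (s∈ss , s∈ts) → apart (All.lookup css s∈ss) (All.lookup cts s∈ts)) ,
    trans (length-++ ss) (cong₂ _+_ lss lts) ,
    Allₚ.++⁺ (All.map (λ c → x , here refl , c) css)
             (All.map (λ (y , y∈ , c) → y , there y∈ , c) cts)
    where
    apart : ∀ {s} → Charged x s → ¬ (∃ λ y → y ∈ˡ xs × Charged y s)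
    apart c (y , y∈ , d) = All.lookup x∉ y∈ (disjoint (here refl) (there y∈) c d)

module EquiWords (n m : ℕ) .{{_ : NonZero m}} (C : List (PointSet n m)) where
  open EquiDifference n m

  opaque
    equiWords : Fin n → List (PointSet n m)
    equiWords i = filter (equiDiff? i) C

    -- The position of a codeword in the list of its row serves as the label of its two extra slots.
    equiWords-index : ∀ {i B} → B ∈ˡ C → EquiDiff i B → ∃ λ k → lookup (equiWords i) k ≡ B
    equiWords-index {i} {B} B∈C equi = index B∈E , sym (lookup-index B∈E)
      where
      B∈E : B ∈ˡ equiWords i
      B∈E = ∈-filter⁺ (equiDiff? i) B∈C equi

    length-equiWords≤Ψᵉ : IsOOC n m C → ∀ i → length (equiWords i) ≤ Ψᵉ m
    length-equiWords≤Ψᵉ ooc i = equiDiff-length≤Ψᵉ ooc i (equiWords i)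
      (Uniqueₚ.filter⁺ (equiDiff? i) (IsOOC.distinct ooc))
      (All.tabulate (proj₁ ∘ ∈-filter⁻ (equiDiff? i)))
      (Allₚ.all-filter (equiDiff? i) C)

-- Charging six slots to each codeword.

module Charging (n m : ℕ) .{{_ : NonZero m}} (C : List (PointSet n m)) (ooc : IsOOC n m C)
  (ψ : ℕ) (length-equiWords : ∀ i → length (EquiWords.equiWords n m C i) ≤ ψ) where
  open Orbits n m
  open EquiDifference n m using (EquiDiff)
  open EquiWords n m C using (equiWords; equiWords-index)
  open IsOOC ooc

  Slot : Set
  Slot = Orbit ⊎ Fin n × Fin 2 × Fin ψ

  -- A relation listing all slots that `B` may occupy: that no two codewords compete for a slot is
  -- proved for it at once, before six slots are selected.
  data Charged (B : PointSet n m) : Slot → Set where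
    pair  : ∀ {p q} → p ∈ B → q ∈ B → p ≢ q → Charged B (inj₁ (orbit p q))
    half  : ∀ {p q} → p ∈ B → q ∈ B → p ≢ q → orbit p q ≡ orbit q p → Charged B (inj₁ (orbit p p))
    extra : ∀ {i ε k} → lookup (equiWords i) k ≡ B →
            Charged B (inj₂ (i , ε , inject≤ k (length-equiWords i)))

  module _ {A B} (A∈C : A ∈ˡ C) (B∈C : B ∈ˡ C) where

    -- The shift carrying `p′`, `q′` to `p`, `q` makes `A` and the shifted `B` share two points,
    -- which cross-correlation forbids for different codewords.
    shared-pair : ∀ {p q p′ q′} → p ∈ A → q ∈ A → p ≢ q → p′ ∈ B → q′ ∈ B →
                  orbit p′ q′ ≡ orbit p q → A ≡ B
    shared-pair {p} {q} {p′} {q′} p∈ q∈ p≢q p′∈ q′∈ e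
      with Vecₚ.≡-dec Bool._≟_ A B | orbit-translation p′ q′ p q e
    ... | yes A≡B | _ = A≡B
    ... | no A≢B | t , tp , tq = contradiction
      (ℕₚ.≤-trans
        (unique⊆⇒length≤ (A ∩ (_⊕_ {n} {m} B t)) ((p≢q ∷ []) ∷ [] ∷ [])
          (x∈p∩q⁺ (p∈ , ∈-⊕⁺ t p′∈ tp) ∷ x∈p∩q⁺ (q∈ , ∈-⊕⁺ t q′∈ tq) ∷ []))
        (All.lookup (All.lookup cross A∈C) B∈C A≢B t))
      λ { (s≤s ()) }

    charged-unique : ∀ {s t} → s ≡ t → Charged A s → Charged B t → A ≡ B
    charged-unique e (pair p∈ q∈ p≢q) (pair p′∈ q′∈ _) =
      shared-pair p∈ q∈ p≢q p′∈ q′∈ (sym (inj₁-injective e))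
    charged-unique e (pair {p} {q} _ _ p≢q) (half {p′} _ _ _ _) =
      contradiction (orbit-diagonal p q p′ (inj₁-injective e)) p≢q
    charged-unique e (half {p} _ _ _ _) (pair {p′} {q′} _ _ p′≢q′) =
      contradiction (orbit-diagonal p′ q′ p (sym (inj₁-injective e))) p′≢q′
    -- A common diagonal orbit only says that the rows agree; uniqueness of the half orbit of a row
    -- then supplies a shared pair.
    charged-unique e (half {p} {q} p∈ q∈ p≢q h) (half {p′} {q′} p′∈ q′∈ p′≢q′ h′) =
      shared-pair p∈ q∈ p≢q p′∈ q′∈
        (sym (half-orbit-unique p q p′ q′ p≢q h p′≢q′ h′ (orbit-rowˡ p p p′ p′ (inj₁-injective e))))
    charged-unique e (extra {i} {k = k} ek) (extra {k = l} el) with inj₂-injective e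
    ... | e′ with cong proj₁ e′
    ... | refl = trans (sym ek) (trans (cong (lookup (equiWords i))
      (inject≤-injective (length-equiWords i) (length-equiWords i) k l (cong (proj₂ ∘ proj₂) e′))) el)

  Charges : PointSet n m → Set
  Charges B = ∃ λ ss → Unique ss × length ss ≡ 6 × All (Charged B) ss

  charged-reverse : ∀ {B p q o} → p ∈ B → q ∈ B → p ≢ q → Reverse p q o → Charged B (inj₁ o)
  charged-reverse p∈ q∈ p≢q (generic _) = pair q∈ p∈ (p≢q ∘ sym)
  charged-reverse p∈ q∈ p≢q (half h) = half p∈ q∈ p≢q h

  -- The shift that takes `(p , q)` to `(q , r)` steps from `p` to `q` to `r`; its residue is the
  -- common difference.
  equiDiff : ∀ {B p q r} → p ∈ B → q ∈ B → r ∈ B → p ≢ q → p ≢ r →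
             orbit p q ≡ orbit q r → EquiDiff (row p) B
  equiDiff {B} {p} {q} {r} p∈ q∈ r∈ p≢q p≢r e with orbit-translation p q q r e
  ... | t , tp , tq = p , refl , a , p∈ ,
    subst (_∈ B) (sym ap) q∈ , subst (_∈ B) (sym 2ap) r∈ ,
    (λ h → p≢q (trans h ap)) , (λ h → p≢r (trans h 2ap))
    where
    open ≡-Reasoning
    a = residue m t
    ap : + toℕ a ⊹ p ≡ q
    ap = trans (⊹-cong (+ toℕ a) t p (toℕ-residue t)) tp
    rearrange : ∀ a t → + 2 ℤ.* (a ℤ.- t) ≡ + 2 ℤ.* a ℤ.- (t ℤ.+ t)
    rearrange = solve-∀
    2ap : (+ 2 ℤ.* + toℕ a) ⊹ p ≡ r
    2ap = begin
      (+ 2 ℤ.* + toℕ a) ⊹ p   ≡⟨ ⊹-cong (+ 2 ℤ.* + toℕ a) (t ℤ.+ t) p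
                                   (subst (+ m ∣ℤ_) (rearrange (+ toℕ a) t) (ℤ∣.∣n⇒∣m*n (+ 2) (toℕ-residue t))) ⟩
      (t ℤ.+ t) ⊹ p           ≡⟨ ⊹-∘ t t p ⟨
      t ⊹ t ⊹ p               ≡⟨ cong (t ⊹_) tp ⟩
      t ⊹ q                   ≡⟨ tq ⟩
      r                       ∎

  module _ {B} (B∈C : B ∈ˡ C) where

    -- Otherwise a translation would permute p, q, r cyclically.
    not-cyclic : ∀ {p q r} → p ∈ B → q ∈ B → r ∈ B → p ≢ q → p ≢ r → q ≢ r →
                 orbit p q ≡ orbit q r → orbit r p ≢ orbit p q
    not-cyclic {p} {q} {r} p∈ q∈ r∈ p≢q p≢r q≢r e e′
      with orbit-translation p q q r e | orbit-translation r p p q e′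
    ... | t , tp , tq | s , sr , sp = contradiction
      (ℕₚ.≤-trans
        (unique⊆⇒length≤ (B ∩ (_⊕_ {n} {m} B t)) ((p≢q ∷ p≢r ∷ []) ∷ (q≢r ∷ []) ∷ [] ∷ [])
          (x∈p∩q⁺ (p∈ , ∈-⊕⁺ t r∈ tr) ∷ x∈p∩q⁺ (q∈ , ∈-⊕⁺ t p∈ tp) ∷ x∈p∩q⁺ (r∈ , ∈-⊕⁺ t q∈ tq) ∷ []))
        (All.lookup auto B∈C t m∤t))
      λ { (s≤s (s≤s ())) }
      where
      tr : t ⊹ r ≡ p
      tr = trans (⊹-cong t s r (⊹-cancel t s p (trans tp (sym sp)))) sr
      m∤t : ¬ _
      m∤t m∣t = p≢q (trans (sym (⊹-identity p)) (trans (⊹-cong 0ℤ t p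
        (subst (+ m ∣ℤ_) (sym (ℤₚ.+-identityˡ (ℤ.- t))) (ℤ∣.∣m⇒∣-m (ℤ∣.∣ᵤ⇒∣ m∣t)))) tp))

    -- The pair `(q , r)` and its reversal repeat the orbits of `(p , q)` and `(q , p)`, so the two
    -- extra slots replace them. The remaining pairs `(r , p)` and `(p , q)` meet in `p` and have
    -- different orbits by `not-cyclic`.
    equiDiff-charges : ∀ {p q r} → p ∈ B → q ∈ B → r ∈ B → p ≢ q → p ≢ r → q ≢ r →
                       orbit p q ≡ orbit q r → Charges B
    equiDiff-charges {p} {q} {r} p∈ q∈ r∈ p≢q p≢r q≢r e =
      build (proj₂ (reverse r p)) (proj₂ (reverse p q))
        (equiWords-index B∈C (equiDiff p∈ q∈ r∈ p≢q p≢r e))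
        (not-cyclic p∈ q∈ r∈ p≢q p≢r q≢r e)
      where
      build : ∀ {o₁ o₂} → Reverse r p o₁ → Reverse p q o₂ →
              (∃ λ k → lookup (equiWords (row p)) k ≡ B) → orbit r p ≢ orbit p q → Charges B
      build {o₁} {o₂} v₁ v₂ (k , kB) ne =
        map inj₁ (orbit r p ∷ o₁ ∷ orbit p q ∷ o₂ ∷ []) ++ slot zero ∷ slot (suc zero) ∷ [] ,
        Uniqueₚ.++⁺
          (Uniqueₚ.map⁺ inj₁-injective
            ((reverse-≢ (p≢r ∘ sym) v₁ ∷ ff ∷ fb ∷ []) ∷ (bf ∷ bb ∷ []) ∷ (reverse-≢ p≢q v₂ ∷ []) ∷ [] ∷ []))
          (((λ ()) ∷ []) ∷ [] ∷ [])
          apart ,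
        refl ,
        pair r∈ p∈ (p≢r ∘ sym) ∷ charged-reverse r∈ p∈ (p≢r ∘ sym) v₁ ∷
        pair p∈ q∈ p≢q ∷ charged-reverse p∈ q∈ p≢q v₂ ∷
        extra kB ∷ extra kB ∷ []
        where
        open Disjoint (adjacent-disjoint (p≢r ∘ sym) p≢q (q≢r ∘ sym) ne v₁ v₂)
        slot : Fin 2 → Slot
        slot ε = inj₂ (row p , ε , inject≤ k (length-equiWords (row p)))
        apart : ∀ {os s} → ¬ (s ∈ˡ map inj₁ os × s ∈ˡ slot zero ∷ slot (suc zero) ∷ [])
        apart (s∈ , s∈′) with ∈-map⁻ inj₁ s∈
        apart (s∈ , here ()) | o , o∈ , refl
        apart (s∈ , there (here ())) | o , o∈ , refl

    -- With the pairs oriented around the cycle `p`, `q`, `r`, any two are consecutive, so three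
    -- uses of `adjacent-disjoint` cover all comparisons.
    scalene-charges : ∀ {p q r} → p ∈ B → q ∈ B → r ∈ B → p ≢ q → p ≢ r → q ≢ r →
      orbit p q ≢ orbit q r → orbit q r ≢ orbit r p → orbit r p ≢ orbit p q → Charges B
    scalene-charges {p} {q} {r} p∈ q∈ r∈ p≢q p≢r q≢r ne₁ ne₂ ne₃ =
      build (proj₂ (reverse p q)) (proj₂ (reverse q r)) (proj₂ (reverse r p))
      where
      build : ∀ {o₁ o₂ o₃} → Reverse p q o₁ → Reverse q r o₂ → Reverse r p o₃ → Charges B
      build {o₁} {o₂} {o₃} v₁ v₂ v₃ =
        map inj₁ (orbit p q ∷ o₁ ∷ orbit q r ∷ o₂ ∷ orbit r p ∷ o₃ ∷ []) ,
        Uniqueₚ.map⁺ inj₁-injective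
          ((reverse-≢ p≢q v₁ ∷ D₁.ff ∷ D₁.fb ∷ (D₃.ff ∘ sym) ∷ (D₃.bf ∘ sym) ∷ []) ∷
           (D₁.bf ∷ D₁.bb ∷ (D₃.fb ∘ sym) ∷ (D₃.bb ∘ sym) ∷ []) ∷
           (reverse-≢ q≢r v₂ ∷ D₂.ff ∷ D₂.fb ∷ []) ∷
           (D₂.bf ∷ D₂.bb ∷ []) ∷
           (reverse-≢ (p≢r ∘ sym) v₃ ∷ []) ∷ [] ∷ []) ,
        refl ,
        pair p∈ q∈ p≢q ∷ charged-reverse p∈ q∈ p≢q v₁ ∷
        pair q∈ r∈ q≢r ∷ charged-reverse q∈ r∈ q≢r v₂ ∷
        pair r∈ p∈ (p≢r ∘ sym) ∷ charged-reverse r∈ p∈ (p≢r ∘ sym) v₃ ∷ []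
        where
        module D₁ = Disjoint (adjacent-disjoint p≢q q≢r p≢r ne₁ v₁ v₂)
        module D₂ = Disjoint (adjacent-disjoint q≢r (p≢r ∘ sym) (p≢q ∘ sym) ne₂ v₂ v₃)
        module D₃ = Disjoint (adjacent-disjoint (p≢r ∘ sym) p≢q (q≢r ∘ sym) ne₃ v₃ v₁)

    triple-charges : ∀ {p q r} → p ∈ B → q ∈ B → r ∈ B → p ≢ q → p ≢ r → q ≢ r → Charges B
    triple-charges {p} {q} {r} p∈ q∈ r∈ p≢q p≢r q≢r
      -- Any coincidence becomes the equi-difference case after rotating the names of the points.
      with orbit p q ≟ᵒ orbit q r | orbit q r ≟ᵒ orbit r p | orbit r p ≟ᵒ orbit p q
    ... | yes e | _ | _ = equiDiff-charges p∈ q∈ r∈ p≢q p≢r q≢r e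
    ... | no _ | yes e | _ = equiDiff-charges q∈ r∈ p∈ q≢r (p≢q ∘ sym) (p≢r ∘ sym) e
    ... | no _ | no _ | yes e = equiDiff-charges r∈ p∈ q∈ (p≢r ∘ sym) (q≢r ∘ sym) p≢q e
    ... | no ne₁ | no ne₂ | no ne₃ = scalene-charges p∈ q∈ r∈ p≢q p≢r q≢r ne₁ ne₂ ne₃

    charges : Charges B
    charges = build (members B)
      where
      build : (∃ λ ps → Unique ps × All (_∈ B) ps × length ps ≡ ∣ B ∣) → Charges B
      build (ps , u , ps⊆B , e) = triple ps u ps⊆B (trans e (All.lookup weight B∈C))
        where
        triple : ∀ ps → Unique ps → All (_∈ B) ps → length ps ≡ 3 → Charges B
        triple (_ ∷ _ ∷ _ ∷ []) ((p≢q ∷ p≢r ∷ []) ∷ (q≢r ∷ []) ∷ _) (p∈ ∷ q∈ ∷ r∈ ∷ []) _ =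
          triple-charges p∈ q∈ r∈ p≢q p≢r q≢r

  totalCharges : ∃ λ ss → Unique ss × length ss ≡ length C * 6 ×
                          All (λ s → ∃ λ B → B ∈ˡ C × Charged B s) ss
  totalCharges = collect 6 distinct charges (λ A∈ B∈ → charged-unique A∈ B∈ refl)

  -- Counting the slots.

  encode : Slot → Fin (n * (n * m + 2 * ψ))
  encode (inj₁ (i , j , d)) = combine i (join (n * m) (2 * ψ) (inj₁ (combine j d)))
  encode (inj₂ (i , ε , k)) = combine i (join (n * m) (2 * ψ) (inj₂ (combine ε k)))

  combine-join-injective : ∀ {i i′ : Fin n} x x′ →
    combine i (join (n * m) (2 * ψ) x) ≡ combine i′ (join (n * m) (2 * ψ) x′) →
    i ≡ i′ × x ≡ x′
  combine-join-injective {i} {i′} x x′ e with combine-injective i _ i′ _ e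
  ... | i≡i′ , e′ = i≡i′ , trans (sym (splitAt-join (n * m) (2 * ψ) x))
    (trans (cong (splitAt (n * m)) e′) (splitAt-join (n * m) (2 * ψ) x′))

  encode-injective : ∀ {s t} → encode s ≡ encode t → s ≡ t
  encode-injective {inj₁ (i , j , d)} {inj₁ (i′ , j′ , d′)} e
    with combine-join-injective (inj₁ (combine j d)) (inj₁ (combine j′ d′)) e
  ... | refl , e′ with combine-injective j d j′ d′ (inj₁-injective e′)
  ... | refl , refl = refl
  encode-injective {inj₁ (i , j , d)} {inj₂ (i′ , ε , k)} e
    with combine-join-injective (inj₁ (combine j d)) (inj₂ (combine ε k)) e
  ... | _ , ()
  encode-injective {inj₂ (i , ε , k)} {inj₁ (i′ , j , d)} e
    with combine-join-injective (inj₂ (combine ε k)) (inj₁ (combine j d)) e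
  ... | _ , ()
  encode-injective {inj₂ (i , ε , k)} {inj₂ (i′ , ε′ , k′)} e
    with combine-join-injective (inj₂ (combine ε k)) (inj₂ (combine ε′ k′)) e
  ... | refl , e′ with combine-injective ε k ε′ k′ (inj₂-injective e′)
  ... | refl , refl = refl

  slots-bound : ∀ {ss : List Slot} → Unique ss → length ss ≤ n * (n * m + 2 * ψ)
  slots-bound {ss} u = subst₂ _≤_ (length-map encode ss) (∣⊤∣≡n _)
    (unique⊆⇒length≤ _ (Uniqueₚ.map⁺ encode-injective u) (All.universal (λ _ → ∈⊤) _))

  even-bound : length C * 6 ≤ n * (n * m + 2 * ψ)
  even-bound with totalCharges
  ... | ss , u , l , _ = subst (_≤ n * (n * m + 2 * ψ)) l (slots-bound u)

  module _ (odd : m % 2 ≡ 1) where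

    no-half : ∀ {p q} → p ≢ q → orbit p q ≢ orbit q p
    no-half {p} {q} p≢q e = contradiction (trans (sym odd) (trans (cong (_% 2) m≡d*2) (m*n%n≡0 d 2))) λ ()
      where
      d = toℕ (residue m (δ p q))
      m≡d*2 : m ≡ d * 2
      m≡d*2 = trans (sym (half-period p q p≢q e))
        (trans (cong (_+_ d) (sym (ℕₚ.+-identityʳ d))) (ℕₚ.*-comm 2 d))

    diagonal : Fin n → Slot
    diagonal i = inj₁ (i , i , residue m 0ℤ)

    -- A diagonal orbit could be charged only as a substitute for a half orbit, and an odd `m` has
    -- no half period.
    diagonal-uncharged : ∀ {B s} i → diagonal i ≡ s → ¬ Charged B s
    diagonal-uncharged i e (half _ _ p≢q h) = no-half p≢q h
    diagonal-uncharged i e (pair {p} {q} _ _ p≢q) = p≢q (point-≡ p q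
      (trans (sym (cong proj₁ o≡)) (cong (λ o → proj₁ (proj₂ o)) o≡))
      (subst (+ m ∣ℤ_) (negate (col p) (col q))
        (residue-≡⇒∣ 0ℤ (δ p q) (cong (λ o → proj₂ (proj₂ o)) o≡))))
      where
      o≡ : (i , i , residue m 0ℤ) ≡ (row p , row q , residue m (δ p q))
      o≡ = trans (inj₁-injective e) (orbit-def p q)
      negate : ∀ a b → 0ℤ ℤ.- (b ℤ.- a) ≡ a ℤ.- b
      negate = solve-∀

    odd-bound : n + length C * 6 ≤ n * (n * m + 2 * ψ)
    odd-bound with totalCharges
    ... | ss , u , l , c = subst (_≤ n * (n * m + 2 * ψ))
      (trans (length-++ (map diagonal (allFin n)))
        (cong₂ _+_ (trans (length-map diagonal (allFin n)) (length-tabulate {n = n} (λ i → i))) l))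
      (slots-bound (Uniqueₚ.++⁺
        (Uniqueₚ.map⁺ (cong proj₁ ∘ inj₁-injective) (Uniqueₚ.allFin⁺ n)) u
        λ (s∈ , s∈ss) → apart (∈-map⁻ diagonal s∈) (All.lookup c s∈ss)))
      where
      apart : ∀ {s} {P : Fin n → Set} → (∃ λ i → P i × s ≡ diagonal i) → ¬ (∃ λ B → B ∈ˡ C × Charged B s)
      apart (i , _ , e) (_ , _ , ch) = diagonal-uncharged i (sym e) ch

-- From slot counts to the floor bounds.

*≤⇒≤/ : ∀ {k N} d .{{_ : NonZero d}} → k * d ≤ N → k ≤ N / d
*≤⇒≤/ {k} {N} d h = subst (_≤ N / d) (m*n/n≡m k d) (/-monoˡ-≤ d h)

-- Accounts for the `- 1` of the odd case: the `n` free diagonal slots amount to one per row.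
+≤*⇒≤*∸1 : ∀ {n c} k → n + c ≤ n * k → c ≤ n * (k ∸ 1)
+≤*⇒≤*∸1 {n} {c} k h = begin
  c               ≡⟨ ℕₚ.m+n∸m≡n n c ⟨
  n + c ∸ n       ≤⟨ ℕₚ.∸-monoˡ-≤ n h ⟩
  n * k ∸ n       ≡⟨ cong (n * k ∸_) (ℕₚ.*-identityʳ n) ⟨
  n * k ∸ n * 1   ≡⟨ ℕₚ.*-distribˡ-∸ n k 1 ⟨
  n * (k ∸ 1)     ∎
  where open ℕₚ.≤-Reasoning

-- The counting uses only that `ψ` bounds the equi-difference codewords in each row; `Ψᵉ m` is such
-- a bound by `length-equiWords≤Ψᵉ`.
size-bound : ∀ n m .{{_ : NonZero m}} {φ} ψ → (∃ λ C → IsOOC n m C × length C ≡ φ) →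
  (∀ C → IsOOC n m C → ∀ i → length (EquiWords.equiWords n m C i) ≤ ψ) →
  (m % 2 ≡ 0 → φ ≤ (n * (n * m + 2 * ψ)) / 6) ×
  (m % 2 ≡ 1 → φ ≤ (n * (n * m + 2 * ψ ∸ 1)) / 6)
size-bound n m ψ (C , ooc , refl) length≤ψ =
  (λ _ → *≤⇒≤/ 6 even-bound) ,
  (λ odd → *≤⇒≤/ 6 (+≤*⇒≤*∸1 (n * m + 2 * ψ) (odd-bound odd)))
  where open Charging n m C ooc ψ (length≤ψ C ooc)

lemma3p2 : (n m : ℕ) .{{_ : NonZero n}} .{{_ : NonZero m}} →
    (m % 2 ≡ 0 → Φ n m ≤ (n * (n * m + 2 * Ψᵉ m)) / 6) ×
    (m % 2 ≡ 1 → Φ n m ≤ (n * (n * m + 2 * Ψᵉ m ∸ 1)) / 6)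
lemma3p2 n m = size-bound n m (Ψᵉ m) (proj₁ (Φ-isLargest n m)) (EquiWords.length-equiWords≤Ψᵉ n m)
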